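{- Let $(X,\mathcal{F})$ be a set system. Then the following are equivalent. 1. $(X,\mathcal{F})$ is a well-graded family with additionality $2$. 2. For every $D\in\mathcal{F}$, the graph $G_{\mathcal{F}'}$ is a uniformly directed semitree, where $\mathcal{F}'=flip(\mathcal{F},D\rightarrow\emptyset)$. 3. For some $D\in\mathcal{F}$, the graph $G_{\mathcal{F}'}$ is a uniformly directed semitree, where $\mathcal{F}'=flip(\mathcal{F},D\rightarrow\emptyset)$. 4. The graph $G_{\mathcal{F}}$ is a semitree.
   Context: A set system $(X,\mathcal{F})$ is a finite set $X$ together with a nonempty family $\mathcal{F}$ of distinct subsets of $X$. Its one-inclusion graph $G_{\mathcal{F}}$ is the edge-labelled directed graph with one vertex $v_A$ for each $A\in\mathcal{F}$ and a directed edge from $v_A$ to $v_B$ with label $b$ whenever $B=A\cup\{b\}$ for some $b\in X\setminus A$. For directed graphs, connectedness, trees, cycles and distances refer to the underlying undirected graph (the distance is infinite if there is no path). The system is well-graded if $|A\triangle B|=d_{G_{\mathcal{F}}}(v_A,v_B)$ for all $A,B\in\mathcal{F}$. $x\in X$ is essential if there are $A,B\in\mathcal{F}$ with $x\in A$, $x\notin B$; $ess_{\mathcal{F}}(X)$ is the set of essential elements. The additionality is $|\mathcal{F}|-|ess_{\mathcal{F}}(X)|$. For $D\in\mathcal{F}$, $flip(\mathcal{F},D\rightarrow\emptyset)$ is the system on $X$ obtained by applying to $\mathcal{F}$ the bit-flip operation on $a$ for every $a\in D$, where bit-flip on $a$ replaces each member $C$ by $C\setminus\{a\}$ if $a\in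 C$ and by $C\cup\{a\}$ if $a\notin C$; i.e. it equals $\{C\triangle D:C\in\mathcal{F}\}$. A parallel-directed-labelled $C_4$ cycle is a labelled directed 4-cycle $a_1a_2a_3a_4$ in which the edges $a_1a_2$ and $a_4a_3$ have the same label and parallel directions (either $a_1\to a_2$ and $a_4\to a_3$, or $a_2\to a_1$ and $a_3\to a_4$), and similarly the edges $a_2a_3$ and $a_1a_4$ have the same label (different from the label of $a_1a_2$ and $a_4a_3$) and parallel directions (either $a_2\to a_3$ and $a_1\to a_4$, or the reverse of both). A labelled directed graph $G$ is a semitree if it consists of a parallel-directed-labelled $C_4$ cycle $a_1a_2a_3a_4$ with four (possibly empty) trees attached to the vertices $a_1,a_2,a_3,a_4$ respectively, such that the labels of edges outside the $C_4$ cycle are different from each other and from the labels of the $C_4$ cycle. A semitree $G$ is uniformly directed if either $G$ is itself a parallel-directed-labelled $C_4$ cycle or there is a vertex $o$ of $G$ such that for every edge $ab$ of $G$, the edge is directed from $a$ to $b$ if and only if $d_G(o,b)>d_G(o,a)$. -}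

module Defs where

open import Data.Bool.Base using (true; false)
open import Data.Fin.Base using (Fin)
open import Data.Fin.Patterns using (0F; 1F; 2F; 3F)
open import Data.Fin.Properties using (any?)
open import Data.Fin.Subset using (Subset; _∈_; _∉_; _∪_; _─_; ⁅_⁆; ∣_∣)
open import Data.Fin.Subset.Properties
  using (_∈?_; x∈⁅x⁆; x∈⁅y⁆⇒x≡y; x∈p∪q⁻; x∈p∪q⁺)
open import Data.Integer.Base using (ℤ; _⊖_)
open import Data.List.Base using (List; []; _∷_; _∷ʳ_; length)
open import Data.List.Relation.Unary.Linked using (Linked)
open import Data.List.Relation.Unary.Unique.Propositional using (Unique)
open import Data.Nat.Base using (ℕ; zero; suc; NonZero; _≤_; _<_)
open import Data.Product.Base using (Σ; ∃; ∃₂; _×_; _,_; proj₁)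
open import Data.Sum.Base using (_⊎_; inj₁; inj₂)
open import Data.Vec.Base using ([]; _∷_; head; tabulate)
open import Data.Vec.Properties using (∷-injective)
open import Function.Bundles using (_⇔_)
open import Function.Definitions using (Injective)
open import Relation.Binary.Construct.Add.Supremum.Strict _<_ using (_<⁺_)
open import Relation.Binary.PropositionalEquality.Core
  using (_≡_; _≢_; refl; sym; cong₂; subst)
open import Relation.Nullary.Construct.Add.Supremum using (_⁺; [_]; ⊤⁺)
open import Relation.Nullary.Decidable.Core using (Dec; does; _×-dec_; ¬?)
open import Relation.Nullary.Negation.Core using (¬_; contradiction)

------------------------------------------------------------------------
-- Edge-labelled directed graphs

-- The underlying undirected graph is simple (`single` and `antisym`
-- exclude parallel edges, opposite edges and loops), so cycles can be
-- described by their vertices.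
record Digraph : Set₁ where
  field
    Vertex  : Set
    Label   : Set
    Edge    : Vertex → Label → Vertex → Set
    single  : ∀ {u v k l} → Edge u k v → Edge u l v → k ≡ l
    antisym : ∀ {u v k l} → Edge u k v → ¬ Edge v l u

  Adj : Vertex → Vertex → Set
  Adj u v = ∃ λ l → Edge u l v ⊎ Edge v l u

  data Walk : Vertex → Vertex → ℕ → Set where
    here : ∀ {u} → Walk u u zero
    step : ∀ {u v w k} → Adj u v → Walk v w k → Walk u w (suc k)

  -- Graph distance as the graph of a function with values in ℕ ∪ {∞},
  -- where ∞ is ⊤⁺.
  data HasDistance (u v : Vertex) : ℕ ⁺ → Set where
    finite   : ∀ {k} → Walk u v k → (∀ {j} → Walk u v j → k ≤ j) →
               HasDistance u v [ k ]
    infinite : (∀ {j} → ¬ Walk u v j) → HasDistance u v ⊤⁺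

  Connected : Set
  Connected = ∀ u v → ∃ λ k → Walk u v k

  HasCycle : Set
  HasCycle = ∃₂ λ (v : Vertex) (vs : List Vertex) →
    2 ≤ length vs × Unique (v ∷ vs) × Linked Adj (v ∷ vs ∷ʳ v)

  IsTree : Set
  IsTree = Vertex × Connected × ¬ HasCycle

induced : (G : Digraph) → (Digraph.Vertex G → Set) → Digraph
induced G P = record
  { Vertex  = Σ Vertex P
  ; Label   = Label
  ; Edge    = λ u l v → Edge (proj₁ u) l (proj₁ v)
  ; single  = single
  ; antisym = antisym
  }
  where open Digraph G

------------------------------------------------------------------------
-- Semitrees

next : Fin 4 → Fin 4
next 0F = 1F
next 1F = 2F
next 2F = 3F
next 3F = 0F

module _ (G : Digraph) where
  open Digraph G

  record ParallelC4 (a : Fin 4 → Vertex) : Set where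
    field
      distinct : Injective _≡_ _≡_ a
      p q      : Label
      p≢q      : p ≢ q
      p-sides  : (Edge (a 0F) p (a 1F) × Edge (a 3F) p (a 2F)) ⊎
                 (Edge (a 1F) p (a 0F) × Edge (a 2F) p (a 3F))
      q-sides  : (Edge (a 1F) q (a 2F) × Edge (a 0F) q (a 3F)) ⊎
                 (Edge (a 2F) q (a 1F) × Edge (a 3F) q (a 0F))

  OnCycle : (Fin 4 → Vertex) → Vertex → Vertex → Set
  OnCycle a u v = ∃ λ i → (u ≡ a i × v ≡ a (next i)) ⊎
                          (u ≡ a (next i) × v ≡ a i)

  -- `part v` says which of the four attached trees contains v; the tree
  -- attached to a i contains a i as the vertex of attachment, so an empty
  -- attachment is the one-vertex tree {a i}.
  record IsSemitree : Set where
    field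
      a        : Fin 4 → Vertex
      cycle    : ParallelC4 a
      part     : Vertex → Fin 4
      attached : ∀ i → part (a i) ≡ i
      trees    : ∀ i → Digraph.IsTree (induced G (λ v → part v ≡ i))
      edges    : ∀ {u l v} → Edge u l v → OnCycle a u v ⊎ part u ≡ part v

    open ParallelC4 cycle using (p; q)

    field
      labels-fresh    : ∀ {u l v} → Edge u l v → ¬ OnCycle a u v →
                        l ≢ p × l ≢ q
      labels-distinct : ∀ {u v u′ v′ l} →
                        Edge u l v → ¬ OnCycle a u v →
                        Edge u′ l v′ → ¬ OnCycle a u′ v′ →
                        u ≡ u′ × v ≡ v′

  IsParallelC4 : Set
  IsParallelC4 = ∃ λ (a : Fin 4 → Vertex) →
    ParallelC4 a ×
    (∀ v → ∃ λ i → v ≡ a i) ×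
    (∀ {u l v} → Edge u l v → OnCycle a u v)

  Closer : Vertex → Vertex → Vertex → Set
  Closer o u v = ∃₂ λ d e → HasDistance o u d × HasDistance o v e × d <⁺ e

  DirectedFrom : Vertex → Set
  DirectedFrom o = ∀ u v → Adj u v → (∃ λ l → Edge u l v) ⇔ Closer o u v

  IsUniformlyDirectedSemitree : Set
  IsUniformlyDirectedSemitree =
    IsSemitree × (IsParallelC4 ⊎ ∃ λ o → DirectedFrom o)

------------------------------------------------------------------------
-- Set systems on the ground set Fin n

infixl 6 _△_
_△_ : ∀ {n} → Subset n → Subset n → Subset n
A △ B = (A ─ B) ∪ (B ─ A)

△-cancelʳ : ∀ {n} (D : Subset n) {A B} → A △ D ≡ B △ D → A ≡ B
△-cancelʳ []      {[]}    {[]}    _  = refl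
△-cancelʳ (d ∷ D) {x ∷ A} {y ∷ B} eq with ∷-injective eq
... | h , t = cong₂ _∷_ (bit d x y h) (△-cancelʳ D t)
  where
  bit : ∀ d x y → head ((x ∷ []) △ (d ∷ [])) ≡ head ((y ∷ []) △ (d ∷ [])) →
        x ≡ y
  bit true  true  true  _  = refl
  bit true  false false _  = refl
  bit false true  true  _  = refl
  bit false false false _  = refl
  bit true  true  false ()
  bit true  false true  ()
  bit false true  false ()
  bit false false true  ()

-- A nonempty finite family of distinct sets, given by an enumeration
-- without repetition.
record SetSystem (n : ℕ) : Set where
  field
    size     : ℕ
    member   : Fin size → Subset n
    nonempty : NonZero size
    distinct : Injective _≡_ _≡_ member

module _ {n : ℕ} where

  infix 4 _∈ₛ_
  _∈ₛ_ : Subset n → SetSystem n → Set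
  A ∈ₛ F = ∃ λ i → SetSystem.member F i ≡ A

  flip-to-∅ : SetSystem n → Subset n → SetSystem n
  flip-to-∅ F D = record
    { size     = size
    ; member   = λ i → member i △ D
    ; nonempty = nonempty
    ; distinct = λ eq → distinct (△-cancelʳ D eq)
    }
    where open SetSystem F

  module _ (F : SetSystem n) where
    open SetSystem F

    oneInclusion : Digraph
    oneInclusion = record
      { Vertex  = Fin size
      ; Label   = Fin n
      ; Edge    = λ i b j → b ∉ member i × member j ≡ member i ∪ ⁅ b ⁆
      ; single  = single
      ; antisym = antisym
      }
      where
      single : ∀ {i j : Fin size} {b c : Fin n} →
               b ∉ member i × member j ≡ member i ∪ ⁅ b ⁆ →
               c ∉ member i × member j ≡ member i ∪ ⁅ c ⁆ → b ≡ c
      single {i} {j} {b} {c} (b∉ , eb) (_ , ec)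
        with x∈p∪q⁻ (member i) ⁅ c ⁆
               (subst (b ∈_) ec
                 (subst (b ∈_) (sym eb) (x∈p∪q⁺ (inj₂ (x∈⁅x⁆ b)))))
      ... | inj₁ b∈ = contradiction b∈ b∉
      ... | inj₂ b∈ = x∈⁅y⁆⇒x≡y c b∈

      antisym : ∀ {i j : Fin size} {b c : Fin n} →
                b ∉ member i × member j ≡ member i ∪ ⁅ b ⁆ →
                ¬ (c ∉ member j × member i ≡ member j ∪ ⁅ c ⁆)
      antisym {c = c} (_ , eb) (c∉ , ec) =
        c∉ (subst (c ∈_) (sym eb) (x∈p∪q⁺ (inj₁
             (subst (c ∈_) (sym ec) (x∈p∪q⁺ (inj₂ (x∈⁅x⁆ c)))))))

    WellGraded : Set
    WellGraded = ∀ i j →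
      Digraph.HasDistance oneInclusion i j [ ∣ member i △ member j ∣ ]

    Essential : Fin n → Set
    Essential x = ∃₂ λ i j → x ∈ member i × x ∉ member j

    essential? : ∀ x → Dec (Essential x)
    essential? x = any? λ i → any? λ j → (x ∈? member i) ×-dec ¬? (x ∈? member j)

    ess : Subset n
    ess = tabulate (λ x → does (essential? x))

    additionality : ℤ
    additionality = size ⊖ ∣ ess ∣

{-# OPTIONS --safe #-}
module Submission where

-- Fix a base vertex o. In a well-graded system every essential label l has
-- a vertex all of whose steps towards o carry the label l. Choosing one such
-- vertex for each l injects the essential labels into the vertices other
-- than o, so the additionality counts the vertices not chosen. It is 2 iff
-- exactly one vertex s besides o is left over. Connecting s to the vertex
-- chosen for the label of a step from s shows that s has a second label
-- towards o, and comparing descents from the two lower neighbours closes a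
-- square below s; all remaining labels occur on one edge each. Conversely, in
-- a semitree a walk that repeats a label can be shortened by excising a piece
-- or by passing to the opposite side of the square, which gives
-- well-gradedness, and with o a corner of the square, s is the opposite
-- corner. Flipping preserves well-gradedness and additionality, and after
-- D → ∅ the distance from ∅ is cardinality, which gives uniform direction.

open import Defs
open import Data.Bool.Base using (Bool; true; false; not; _xor_)
import Data.Bool.Properties as Bool
open import Data.Empty using (⊥; ⊥-elim)
open import Data.Fin.Base using (Fin; zero; suc; fromℕ<)
open import Data.Fin.Patterns using (0F; 1F; 2F; 3F)
open import Data.Fin.Properties using (any?; suc-injective) renaming (_≟_ to _≟ᶠ_)
open import Data.Fin.Subset using (Subset; _∈_; _∉_; _⊆_; _∪_; _-_; ∁; ⁅_⁆; ∣_∣)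
  renaming (⊥ to ∅)
open import Data.Fin.Subset.Properties
open import Data.Integer.Base using (+_; _⊖_)
import Data.Integer.Properties as ℤ
open import Data.List.Base using ([]; _∷_; _∷ʳ_)
open import Data.List.Relation.Unary.All as All using (All; []; _∷_)
open import Data.List.Relation.Unary.AllPairs using ([]; _∷_)
open import Data.List.Relation.Unary.Linked using (Linked; _∷_)
open import Data.Nat.Base using (ℕ; zero; suc; _∸_; _≤_; _<_; s≤s; ≢-nonZero⁻¹)
import Data.Nat.Properties as ℕ
open import Data.Product.Base using (Σ; ∃; ∃₂; _×_; _,_; proj₁; proj₂)
open import Data.Sum.Base using (_⊎_; inj₁; inj₂)
open import Data.Vec.Base using ([]; _∷_; lookup; updateAt; here; there)
import Data.Vec.Properties as Vec
open import Function.Base using (_∘_)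
open import Function.Bundles using (_⇔_; mk⇔)
open import Relation.Binary.Construct.Add.Supremum.Strict _<_ using ([_])
open import Relation.Binary.PropositionalEquality.Core
  using (_≡_; _≢_; refl; sym; trans; cong; cong₂; subst; subst₂)
open import Relation.Nullary.Construct.Add.Supremum using ([_])
open import Relation.Nullary.Decidable
  using (Dec; does; yes; no; _×-dec_; _⊎-dec_; ¬?; dec-true)
open import Relation.Nullary.Negation.Core using (¬_; contradiction)

private
  variable
    n : ℕ

-- Booleans, toggling and symmetric difference.

≢-common : {x y z : Bool} → x ≢ z → y ≢ z → x ≡ y
≢-common x≢z y≢z = trans (Bool.¬-not x≢z) (sym (Bool.¬-not y≢z))

xor-cancelʳ : ∀ a b → (a xor b) xor b ≡ a
xor-cancelʳ a b = trans (Bool.xor-assoc a b b)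
  (trans (cong (a xor_) (Bool.xor-same b)) (Bool.xor-identityʳ a))

xor-injectiveˡ : ∀ {a b} c → a xor c ≡ b xor c → a ≡ b
xor-injectiveˡ {a} {b} c e =
  trans (sym (xor-cancelʳ a c)) (trans (cong (_xor c) e) (xor-cancelʳ b c))

toggle : Fin n → Subset n → Subset n
toggle l A = updateAt A l not

toggle-involutive : (l : Fin n) (A : Subset n) → toggle l (toggle l A) ≡ A
toggle-involutive l A = trans (Vec.updateAt-updateAt l A)
  (Vec.updateAt-id-local l A (Bool.not-involutive _))

toggle-commutes : (k l : Fin n) (A : Subset n) →
                  toggle k (toggle l A) ≡ toggle l (toggle k A)
toggle-commutes k l A with k ≟ᶠ l
... | yes refl = refl
... | no k≢l   = Vec.updateAt-commutes k l k≢l A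

∪⁅⁆≡toggle : (l : Fin n) (A : Subset n) → lookup A l ≡ false →
             A ∪ ⁅ l ⁆ ≡ toggle l A
∪⁅⁆≡toggle zero    (false ∷ A) _ = cong (true ∷_) (∪-identityʳ A)
∪⁅⁆≡toggle (suc l) (true ∷ A)  e = cong (true ∷_) (∪⁅⁆≡toggle l A e)
∪⁅⁆≡toggle (suc l) (false ∷ A) e = cong (false ∷_) (∪⁅⁆≡toggle l A e)

∣toggle∣ : (l : Fin n) (A : Subset n) → lookup A l ≡ false →
           ∣ toggle l A ∣ ≡ suc ∣ A ∣
∣toggle∣ zero    (false ∷ A) _ = refl
∣toggle∣ (suc l) (true ∷ A)  e = cong suc (∣toggle∣ l A e)
∣toggle∣ (suc l) (false ∷ A) e = ∣toggle∣ l A e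

∉⇒lookup : {l : Fin n} {A : Subset n} → l ∉ A → lookup A l ≡ false
∉⇒lookup {l = l} {A} l∉A = Bool.¬-not (l∉A ∘ Vec.lookup⇒[]= l A)

lookup⇒∉ : {l : Fin n} {A : Subset n} → lookup A l ≡ false → l ∉ A
lookup⇒∉ e l∈A with () ← trans (sym e) (Vec.[]=⇒lookup l∈A)

∣∪⁅⁆∣ : {l : Fin n} {A : Subset n} → l ∉ A → ∣ A ∪ ⁅ l ⁆ ∣ ≡ suc ∣ A ∣
∣∪⁅⁆∣ {l = l} {A} l∉A =
  trans (cong ∣_∣ (∪⁅⁆≡toggle l A (∉⇒lookup l∉A))) (∣toggle∣ l A (∉⇒lookup l∉A))

lookup-△ : (A D : Subset n) (l : Fin n) →
           lookup (A △ D) l ≡ lookup A l xor lookup D l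
lookup-△ (true ∷ A)  (true ∷ D)  zero = refl
lookup-△ (true ∷ A)  (false ∷ D) zero = refl
lookup-△ (false ∷ A) (true ∷ D)  zero = refl
lookup-△ (false ∷ A) (false ∷ D) zero = refl
lookup-△ (a ∷ A)     (d ∷ D)     (suc l) = lookup-△ A D l

toggle-△ : (l : Fin n) (A D : Subset n) → toggle l A △ D ≡ toggle l (A △ D)
toggle-△ zero (true ∷ A)  (true ∷ D)  = refl
toggle-△ zero (true ∷ A)  (false ∷ D) = refl
toggle-△ zero (false ∷ A) (true ∷ D)  = refl
toggle-△ zero (false ∷ A) (false ∷ D) = refl
toggle-△ (suc l) (a ∷ A)  (d ∷ D)     = cong (_ ∷_) (toggle-△ l A D)

A△A≡∅ : (A : Subset n) → A △ A ≡ ∅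
A△A≡∅ []          = refl
A△A≡∅ (true ∷ A)  = cong (false ∷_) (A△A≡∅ A)
A△A≡∅ (false ∷ A) = cong (false ∷_) (A△A≡∅ A)

∣A△A∣≡0 : (A : Subset n) → ∣ A △ A ∣ ≡ 0
∣A△A∣≡0 {n} A = trans (cong ∣_∣ (A△A≡∅ A)) (∣⊥∣≡0 n)

△-comm : (A B : Subset n) → A △ B ≡ B △ A
△-comm A B = ∪-comm _ _

∣toggle△∣ : (l : Fin n) (A B : Subset n) → lookup A l ≡ lookup B l →
            ∣ toggle l A △ B ∣ ≡ suc ∣ A △ B ∣
∣toggle△∣ l A B e = trans (cong ∣_∣ (toggle-△ l A B))
  (∣toggle∣ l (A △ B) (trans (lookup-△ A B l)
    (trans (cong (_xor lookup B l) e) (Bool.xor-same (lookup B l)))))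

-- Images and pairs in finite sets.

image : ∀ {a b} → Subset a → (Fin a → Fin b) → Subset b
image []          g = ∅
image (true ∷ S)  g = image S (g ∘ suc) ∪ ⁅ g zero ⁆
image (false ∷ S) g = image S (g ∘ suc)

∈-image⁺ : ∀ {a b} (S : Subset a) {g : Fin a → Fin b} {x} → x ∈ S → g x ∈ image S g
∈-image⁺ (true ∷ S)  here      = x∈p∪q⁺ (inj₂ (x∈⁅x⁆ _))
∈-image⁺ (true ∷ S)  (there i) = x∈p∪q⁺ (inj₁ (∈-image⁺ S i))
∈-image⁺ (false ∷ S) (there i) = ∈-image⁺ S i

∈-image⁻ : ∀ {a b} (S : Subset a) {g : Fin a → Fin b} {y} →
           y ∈ image S g → ∃ λ x → x ∈ S × y ≡ g x
∈-image⁻ []          y∈ = contradiction y∈ ∉⊥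
∈-image⁻ (true ∷ S)  {g} y∈ with x∈p∪q⁻ (image S (g ∘ suc)) _ y∈
... | inj₂ y∈⁅⁆ = zero , here , x∈⁅y⁆⇒x≡y _ y∈⁅⁆
... | inj₁ y∈′ with x , x∈S , eq ← ∈-image⁻ S y∈′ = suc x , there x∈S , eq
∈-image⁻ (false ∷ S) y∈ with x , x∈S , eq ← ∈-image⁻ S y∈ = suc x , there x∈S , eq

∣image∣ : ∀ {a b} (S : Subset a) (g : Fin a → Fin b) →
          (∀ {x y} → x ∈ S → y ∈ S → g x ≡ g y → x ≡ y) → ∣ image S g ∣ ≡ ∣ S ∣
∣image∣ {b = b} []          g inj = ∣⊥∣≡0 b
∣image∣ (true ∷ S)  g inj =
  trans (∣∪⁅⁆∣ fresh)
    (cong suc (∣image∣ S _ λ i j e → suc-injective (inj (there i) (there j) e)))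
  where
  fresh : g zero ∉ image S (g ∘ suc)
  fresh i with x , x∈S , eq ← ∈-image⁻ S i with () ← inj here (there x∈S) eq
∣image∣ (false ∷ S) g inj = ∣image∣ S _ λ i j e → suc-injective (inj (there i) (there j) e)

IsPair : Fin n → Fin n → Subset n → Set
IsPair x y U = x ≢ y × x ∈ U × y ∈ U × (∀ {z} → z ∈ U → z ≡ x ⊎ z ≡ y)

∣⁅⁆∪⁅⁆∣ : {x y : Fin n} → x ≢ y → ∣ ⁅ x ⁆ ∪ ⁅ y ⁆ ∣ ≡ 2
∣⁅⁆∪⁅⁆∣ {x = x} x≢y =
  trans (∣∪⁅⁆∣ (x≢y⇒x∉⁅y⁆ (x≢y ∘ sym))) (cong suc (∣⁅x⁆∣≡1 x))

pair⇒∣∣≡2 : {U : Subset n} {x y : Fin n} → IsPair x y U → ∣ U ∣ ≡ 2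
pair⇒∣∣≡2 {U = U} {x} {y} (x≢y , x∈U , y∈U , only) =
  trans (cong ∣_∣ (⊆-antisym U⊆ ⊆U)) (∣⁅⁆∪⁅⁆∣ x≢y)
  where
  U⊆ : U ⊆ ⁅ x ⁆ ∪ ⁅ y ⁆
  U⊆ z∈U with only z∈U
  ... | inj₁ refl = x∈p∪q⁺ (inj₁ (x∈⁅x⁆ _))
  ... | inj₂ refl = x∈p∪q⁺ (inj₂ (x∈⁅x⁆ _))
  ⊆U : ⁅ x ⁆ ∪ ⁅ y ⁆ ⊆ U
  ⊆U z∈ with x∈p∪q⁻ ⁅ x ⁆ ⁅ y ⁆ z∈
  ... | inj₁ i with refl ← x∈⁅y⁆⇒x≡y x i = x∈U
  ... | inj₂ i with refl ← x∈⁅y⁆⇒x≡y y i = y∈U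

∣∣≡2⇒pair : {U : Subset n} {x : Fin n} → ∣ U ∣ ≡ 2 → x ∈ U → ∃ λ y → IsPair x y U
∣∣≡2⇒pair {U = U} {x} ∣U∣≡2 x∈U with any? (λ y → (y ∈? U) ×-dec ¬? (y ≟ᶠ x))
... | no none = contradiction
  (subst₂ _≤_ ∣U∣≡2 (∣⁅x⁆∣≡1 x) (p⊆q⇒∣p∣≤∣q∣ U⊆⁅x⁆)) λ { (s≤s ()) }
  where
  U⊆⁅x⁆ : U ⊆ ⁅ x ⁆
  U⊆⁅x⁆ {z} z∈U with z ≟ᶠ x
  ... | yes refl = x∈⁅x⁆ x
  ... | no z≢x   = contradiction (z , z∈U , z≢x) none
... | yes (y , y∈U , y≢x) = y , y≢x ∘ sym , x∈U , y∈U , only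
  where
  module _ {z} (z∈U : z ∈ U) (z≢x : z ≢ x) (z≢y : z ≢ y) where
    ⊆U : ⁅ x ⁆ ∪ ⁅ y ⁆ ∪ ⁅ z ⁆ ⊆ U
    ⊆U w∈ with x∈p∪q⁻ ⁅ x ⁆ _ w∈
    ... | inj₁ i with refl ← x∈⁅y⁆⇒x≡y x i = x∈U
    ... | inj₂ w∈′ with x∈p∪q⁻ ⁅ y ⁆ ⁅ z ⁆ w∈′
    ... | inj₁ i with refl ← x∈⁅y⁆⇒x≡y y i = y∈U
    ... | inj₂ i with refl ← x∈⁅y⁆⇒x≡y z i = z∈U
    z∉ : z ∉ ⁅ x ⁆ ∪ ⁅ y ⁆
    z∉ z∈ with x∈p∪q⁻ ⁅ x ⁆ ⁅ y ⁆ z∈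
    ... | inj₁ i = z≢x (x∈⁅y⁆⇒x≡y x i)
    ... | inj₂ i = z≢y (x∈⁅y⁆⇒x≡y y i)
    three : ∣ ⁅ x ⁆ ∪ ⁅ y ⁆ ∪ ⁅ z ⁆ ∣ ≡ 3
    three = trans (cong ∣_∣ (sym (∪-assoc ⁅ x ⁆ ⁅ y ⁆ ⁅ z ⁆)))
      (trans (∣∪⁅⁆∣ z∉) (cong suc (∣⁅⁆∪⁅⁆∣ (y≢x ∘ sym))))
    absurd : ⊥
    absurd with s≤s (s≤s ()) ← subst₂ _≤_ three ∣U∣≡2 (p⊆q⇒∣p∣≤∣q∣ ⊆U)
  only : ∀ {z} → z ∈ U → z ≡ x ⊎ z ≡ y
  only {z} z∈U with z ≟ᶠ x | z ≟ᶠ y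
  ... | yes z≡x | _       = inj₁ z≡x
  ... | _       | yes z≡y = inj₂ z≡y
  ... | no z≢x  | no z≢y  = ⊥-elim (absurd z∈U z≢x z≢y)

-- Label flips in the one-inclusion graph.

module Graded {n : ℕ} (F : SetSystem n) where
  open SetSystem F
  open Digraph (oneInclusion F)

  bit : Vertex → Label → Bool
  bit v l = lookup (member v) l

  -- An edge labelled `l` with its direction forgotten; the bit of `u` at `l` recovers the
  -- direction.
  Flip : Vertex → Label → Vertex → Set
  Flip u l v = member v ≡ toggle l (member u)

  flip-sym : ∀ {u l v} → Flip u l v → Flip v l u
  flip-sym {u} {l} f = sym (trans (cong (toggle l) f) (toggle-involutive l (member u)))

  flip-functional : ∀ {u l v w} → Flip u l v → Flip u l w → v ≡ w
  flip-functional f g = distinct (trans f (sym g))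

  flip-at : ∀ {u l v} → Flip u l v → bit v l ≡ not (bit u l)
  flip-at {u} {l} f =
    trans (cong (λ A → lookup A l) f) (Vec.lookup∘updateAt l (member u))

  flip-off : ∀ {u l v k} → Flip u l v → k ≢ l → bit v k ≡ bit u k
  flip-off {u} {l} {k = k} f k≢l =
    trans (cong (λ A → lookup A k) f) (Vec.lookup∘updateAt′ k l k≢l (member u))

  flip-changes : ∀ {u l v} → Flip u l v → bit v l ≢ bit u l
  flip-changes f e = Bool.not-¬ e (flip-at f)

  changed⇒label : ∀ {u l v k} → Flip u l v → bit v k ≢ bit u k → k ≡ l
  changed⇒label {l = l} {k = k} f ne with k ≟ᶠ l
  ... | yes k≡l = k≡l
  ... | no k≢l  = contradiction (flip-off f k≢l) ne

  flip-label : ∀ {u v k l} → Flip u k v → Flip u l v → k ≡ l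
  flip-label f g = changed⇒label g (flip-changes f)

  flip? : ∀ u l v → Dec (Flip u l v)
  flip? u l v = Vec.≡-dec Bool._≟_ (member v) (toggle l (member u))

  edge⇒low : ∀ {u l v} → Edge u l v → bit u l ≡ false
  edge⇒low (l∉ , _) = ∉⇒lookup l∉

  edge⇒flip : ∀ {u l v} → Edge u l v → Flip u l v
  edge⇒flip {u} {l} (l∉ , e) = trans e (∪⁅⁆≡toggle l (member u) (∉⇒lookup l∉))

  flip⇒edge : ∀ {u l v} → Flip u l v → bit u l ≡ false → Edge u l v
  flip⇒edge {u} {l} f e = lookup⇒∉ e , trans f (sym (∪⁅⁆≡toggle l (member u) e))

  adj⇒flip : ∀ {u v} → Adj u v → ∃ λ l → Flip u l v
  adj⇒flip (l , inj₁ e) = l , edge⇒flip e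
  adj⇒flip (l , inj₂ e) = l , flip-sym (edge⇒flip e)

  flip⇒adj : ∀ {u l v} → Flip u l v → Adj u v
  flip⇒adj {u} {l} f with bit u l in e
  ... | false = l , inj₁ (flip⇒edge f e)
  ... | true  = l , inj₂ (flip⇒edge (flip-sym f) (trans (flip-at f) (cong not e)))

  -- Geodesics and well-gradedness.

  Toward : Vertex → Vertex → Label → Vertex → Set
  Toward t u l w = Flip u l w × bit w l ≡ bit t l

  toward? : ∀ t u l w → Dec (Toward t u l w)
  toward? t u l w = flip? u l w ×-dec (bit w l Bool.≟ bit t l)

  away : ∀ {t u l w} → Toward t u l w → bit u l ≢ bit t l
  away (f , e) e′ = flip-changes f (trans e (sym e′))

  toward : ∀ {t u l w} → Flip u l w → bit u l ≢ bit t l → Toward t u l w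
  toward f ne = f , ≢-common (flip-changes f) (ne ∘ sym)

  -- Each step repairs one bit and none is spoiled later, so no label is crossed twice and the
  -- length is `dist u t`.
  data Geodesic (t : Vertex) : Vertex → Set where
    here : Geodesic t t
    step : ∀ {u l w} → Toward t u l w → Geodesic t w → Geodesic t u

  AllGeodesic : Set
  AllGeodesic = ∀ t u → Geodesic t u

  Between : Vertex → Vertex → Vertex → Set
  Between x u t = ∀ k → bit x k ≡ bit u k ⊎ bit x k ≡ bit t k

  -- Steps with other labels keep the bit at `l`, so the difference persists until a step carries
  -- `l` itself. A geodesic only ever changes a bit to its value at `t`, whence `Between`: `x` lies
  -- in the interval of the cube spanned by `u` and `t`.
  crossing : ∀ {t u l} → Geodesic t u → bit u l ≢ bit t l →
             ∃₂ λ x y → Toward t x l y × Geodesic t y × Between x u t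
  crossing here ne = contradiction refl ne
  crossing {t} {u} {l} (step {l = k} {w} s g) ne with l ≟ᶠ k
  ... | yes refl = u , w , s , g , λ _ → inj₁ refl
  ... | no l≢k
    with x , y , s′ , g′ , bt ← crossing g (ne ∘ trans (sym (flip-off (proj₁ s) l≢k)))
    = x , y , s′ , g′ , between
    where
    between : Between x u t
    between j with bt j | j ≟ᶠ k
    ... | inj₂ e | _        = inj₂ e
    ... | inj₁ e | yes refl = inj₂ (trans e (proj₂ s))
    ... | inj₁ e | no j≢k   = inj₁ (trans e (flip-off (proj₁ s) j≢k))

  dist : Vertex → Vertex → ℕ
  dist u v = ∣ member u △ member v ∣

  dist-comm : ∀ u v → dist u v ≡ dist v u
  dist-comm u v = cong ∣_∣ (△-comm (member u) (member v))

  toward-dist : ∀ {t u l w} → Toward t u l w → dist u t ≡ suc (dist w t)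
  toward-dist {t} {u} {l} {w} (f , e) = trans
    (cong (λ A → ∣ A △ member t ∣) (flip-sym f)) (∣toggle△∣ l (member w) (member t) e)

  flip-dist : ∀ t {u l w} → Flip u l w → dist u t ≤ suc (dist w t)
  flip-dist t {u} {l} {w} f with bit w l Bool.≟ bit t l
  ... | yes e = ℕ.≤-reflexive (toward-dist (f , e))
  ... | no ne  = ℕ.m≤n⇒m≤1+n (ℕ.≤-trans (ℕ.n≤1+n _)
    (ℕ.≤-reflexive (sym (toward-dist (toward (flip-sym f) ne)))))

  walk-bound : ∀ {u t k} → Walk u t k → dist u t ≤ k
  walk-bound {u} here = ℕ.≤-reflexive (∣A△A∣≡0 (member u))
  walk-bound {t = t} (step a W) with _ , f ← adj⇒flip a =
    ℕ.≤-trans (flip-dist t f) (s≤s (walk-bound W))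

  geodesic-walk : ∀ {t u} → Geodesic t u → Walk u t (dist u t)
  geodesic-walk {t} here = subst (Walk t t) (sym (∣A△A∣≡0 (member t))) here
  geodesic-walk {t} {u} (step s g) = subst (Walk u t) (sym (toward-dist s))
    (step (flip⇒adj (proj₁ s)) (geodesic-walk g))

  geodesic⇒wellGraded : AllGeodesic → WellGraded F
  geodesic⇒wellGraded geo u t = finite (geodesic-walk (geo t u)) walk-bound

  -- A walk of length `dist u t` has no step to spare: after a step away from `t` the rest would be
  -- shorter than `walk-bound` allows.
  shortest⇒geodesic : ∀ {u t k} → Walk u t k → k ≡ dist u t → Geodesic t u
  shortest⇒geodesic here _ = here
  shortest⇒geodesic {u} {t} (step {v = w} a W) e with l , f ← adj⇒flip a
    with bit w l Bool.≟ bit t l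
  ... | yes e′ = step (f , e′)
    (shortest⇒geodesic W (ℕ.suc-injective (trans e (toward-dist (f , e′)))))
  ... | no ne = contradiction
    (ℕ.≤-trans (ℕ.≤-reflexive (trans (cong suc e)
                 (sym (toward-dist (toward (flip-sym f) ne)))))
      (walk-bound W))
    (ℕ.<⇒≱ (ℕ.n<1+n _) ∘ ℕ.≤-trans (ℕ.n≤1+n _))

  wellGraded⇒geodesic : WellGraded F → AllGeodesic
  wellGraded⇒geodesic wg t u with finite W _ ← wg u t = shortest⇒geodesic W refl

  -- Squares.

  parallel-flip : ∀ {u w x y k l} → Flip u l w → Flip x l y → Flip u k x → Flip w k y
  parallel-flip {u} {k = k} {l} f g h = trans g (trans (cong (toggle l) h)
    (trans (toggle-commutes l k (member u)) (cong (toggle k) (sym f))))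

  -- Corners are indexed by their own bits at `p` and `q` rather than in cyclic order, so moving
  -- along a side negates one index.
  record Square : Set where
    field
      corner : Bool → Bool → Vertex
      p q    : Label
      p≢q    : p ≢ q
      at-p   : ∀ α β → bit (corner α β) p ≡ α
      at-q   : ∀ α β → bit (corner α β) q ≡ β
      flip-p : ∀ α β → Flip (corner α β) p (corner (not α) β)
      flip-q : ∀ α β → Flip (corner α β) q (corner α (not β))

    IsCorner : Vertex → Set
    IsCorner v = v ≡ corner (bit v p) (bit v q)

    isCorner-flip : ∀ {u l v} → Flip u l v → l ≡ p ⊎ l ≡ q → IsCorner u → IsCorner v
    isCorner-flip {u} {v = v} f (inj₁ refl) e = trans
      (flip-functional f (subst (λ z → Flip z p (corner (not (bit u p)) (bit u q)))
        (sym e) (flip-p (bit u p) (bit u q))))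
      (sym (cong₂ corner (flip-at f) (flip-off f (p≢q ∘ sym))))
    isCorner-flip {u} {v = v} f (inj₂ refl) e = trans
      (flip-functional f (subst (λ z → Flip z q (corner (bit u p) (not (bit u q))))
        (sym e) (flip-q (bit u p) (bit u q))))
      (sym (cong₂ corner (flip-off f p≢q) (flip-at f)))

  module _ {t a b s p q} (p≢q : p ≢ q)
           (f : Flip t p a) (g : Flip t q b) (h : Flip a q s) where

    -- Corners indexed by their differences from `t`; xor with the bits of `t` gives the absolute
    -- indexing of `Square`. The side from `b` to `s` comes from the other three by `parallel-flip`.
    relative : Bool → Bool → Vertex
    relative false false = t
    relative true  false = a
    relative false true  = b
    relative true  true  = s

    relative-p : ∀ x y → Flip (relative x y) p (relative (not x) y)
    relative-p false false = f
    relative-p true  false = flip-sym f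
    relative-p false true  = parallel-flip g h f
    relative-p true  true  = parallel-flip h g (flip-sym f)

    relative-q : ∀ x y → Flip (relative x y) q (relative x (not y))
    relative-q false false = g
    relative-q true  false = h
    relative-q false true  = flip-sym g
    relative-q true  true  = flip-sym h

    relative-at-p : ∀ x y → bit (relative x y) p ≡ x xor bit t p
    relative-at-p false false = refl
    relative-at-p true  false = flip-at f
    relative-at-p false true  = flip-off g p≢q
    relative-at-p true  true  = trans (flip-off h p≢q) (flip-at f)

    relative-at-q : ∀ x y → bit (relative x y) q ≡ y xor bit t q
    relative-at-q false false = refl
    relative-at-q true  false = flip-off f (p≢q ∘ sym)
    relative-at-q false true  = flip-at g
    relative-at-q true  true  = trans (flip-at h) (cong not (flip-off f (p≢q ∘ sym)))

    square-from-path : Square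
    square-from-path = record
      { corner = λ α β → relative (α xor bit t p) (β xor bit t q)
      ; p      = p
      ; q      = q
      ; p≢q    = p≢q
      ; at-p   = λ α β → trans (relative-at-p (α xor bit t p) (β xor bit t q))
          (xor-cancelʳ α _)
      ; at-q   = λ α β → trans (relative-at-q (α xor bit t p) (β xor bit t q))
          (xor-cancelʳ β _)
      ; flip-p = λ α β → trans
          (cong (λ z → member (relative z (β xor bit t q))) (sym (Bool.not-distribˡ-xor α _)))
          (relative-p (α xor bit t p) (β xor bit t q))
      ; flip-q = λ α β → trans
          (cong (λ z → member (relative (α xor bit t p) z)) (sym (Bool.not-distribˡ-xor β _)))
          (relative-q (α xor bit t p) (β xor bit t q))
      }

    relative-corner : ∀ x y → Square.IsCorner square-from-path (relative x y)
    relative-corner x y = sym (cong₂ relative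
      (trans (cong (_xor bit t p) (relative-at-p x y)) (xor-cancelʳ x _))
      (trans (cong (_xor bit t q) (relative-at-q x y)) (xor-cancelʳ y _)))

  -- Rigid systems.

  -- A semitree in terms of labels alone: acyclicity of the attached trees
  -- is a consequence, since a cycle crosses each of its labels twice.
  record Rigid : Set where
    field
      square : Square
    open Square square public
    field
      on-square : ∀ {u l v} → Flip u l v → l ≡ p ⊎ l ≡ q → IsCorner u
      rigid     : ∀ {u l w x y} → l ≢ p → l ≢ q → Flip u l w → Flip x l y →
                  bit u l ≡ bit x l → u ≡ x
      connected : Connected

    -- For labels other than `p` and `q` this is rigidity. Edges labelled `p` or `q` join corners,
    -- and two corners with the same bit at `l` coincide or are joined by a side with the other
    -- label.
    parallel : ∀ {u l w x y} → Flip u l w → Flip x l y → bit u l ≡ bit x l →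
               u ≡ x ⊎ ∃ λ k → Flip u k x × ((k ≡ p × l ≡ q) ⊎ (k ≡ q × l ≡ p))
    parallel {u} {l} {w} {x} f g e with l ≟ᶠ p | l ≟ᶠ q
    ... | no l≢p | no l≢q = inj₁ (rigid l≢p l≢q f g e)
    ... | yes refl | _ with bit x q Bool.≟ bit u q
    ...   | yes e′ = inj₁ (trans (on-square f (inj₁ refl))
                       (trans (cong₂ corner e (sym e′)) (sym (on-square g (inj₁ refl)))))
    ...   | no ne   = inj₂ (q , subst₂ (λ a b → Flip a q b) (sym (on-square f (inj₁ refl)))
                       (trans (cong₂ corner e (sym (Bool.¬-not ne)))
                         (sym (on-square g (inj₁ refl))))
                       (flip-q (bit u p) (bit u q)) , inj₂ (refl , refl))
    parallel {u} {l} {w} {x} f g e | no _ | yes refl with bit x p Bool.≟ bit u p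
    ...   | yes e′ = inj₁ (trans (on-square f (inj₂ refl))
                       (trans (cong₂ corner (sym e′) e) (sym (on-square g (inj₂ refl)))))
    ...   | no ne   = inj₂ (p , subst₂ (λ a b → Flip a p b) (sym (on-square f (inj₂ refl)))
                       (trans (cong₂ corner (sym (Bool.¬-not ne)) e)
                         (sym (on-square g (inj₂ refl))))
                       (flip-p (bit u p) (bit u q)) , inj₁ (refl , refl))

    pq-distinct : ∀ {k l} → (k ≡ p × l ≡ q) ⊎ (k ≡ q × l ≡ p) → k ≢ l
    pq-distinct (inj₁ (refl , refl)) = p≢q
    pq-distinct (inj₂ (refl , refl)) = p≢q ∘ sym

    -- If the first step w—u undoes an agreement with t, the geodesic from w
    -- crosses the same label again, either at the same edge or at the
    -- opposite side of the square; both cases give a shortcut from u.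
    extend : ∀ {t u l w} → Flip u l w → Geodesic t w → Geodesic t u
    extend {t} {u} {l} {w} f γ with bit w l Bool.≟ bit t l
    ... | yes e = step (f , e) γ
    ... | no ne with x , y , (h , e) , γ′ , between ← crossing γ ne
          with parallel (flip-sym f) h (≢-common ne (away (h , e)))
    ...   | inj₁ refl = subst (Geodesic t) (flip-functional h (flip-sym f)) γ′
    ...   | inj₂ (k , f′ , kl) = step (parallel-flip (flip-sym f) h f′ , agree) γ′
      where
      agree : bit y k ≡ bit t k
      agree with between k
      ... | inj₁ e′ = contradiction e′ (flip-changes f′)
      ... | inj₂ e′ = trans (flip-off h (pq-distinct kl)) e′

    -- Connectedness supplies a walk to `t`, which `extend` straightens step by step, starting from
    -- its end at `t`.
    allGeodesic : AllGeodesic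
    allGeodesic t u = go (proj₂ (connected u t))
      where
      go : ∀ {u t k} → Walk u t k → Geodesic t u
      go here       = here
      go (step a W) = extend (proj₂ (adj⇒flip a)) (go W)

  -- Essential labels, irreducible vertices and additionality.

  essential⇒separated : ∀ {l} → Essential F l → ∃₂ λ u v → bit u l ≢ bit v l
  essential⇒separated (u , v , l∈u , l∉v) =
    u , v , λ e → l∉v (Vec.lookup⇒[]= _ _ (trans (sym e) (Vec.[]=⇒lookup l∈u)))

  separated⇒essential : ∀ {l u v} → bit u l ≢ bit v l → Essential F l
  separated⇒essential {l} {u} {v} ne with bit u l in eu | bit v l in ev
  ... | true  | true  = contradiction refl ne
  ... | false | false = contradiction refl ne
  ... | true  | false = u , v , Vec.lookup⇒[]= l _ eu , lookup⇒∉ ev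
  ... | false | true  = v , u , Vec.lookup⇒[]= l _ ev , lookup⇒∉ eu

  ∈ess⁻ : ∀ {l} → l ∈ ess F → Essential F l
  ∈ess⁻ {l} l∈ with essential? F l
                  | trans (sym (Vec.lookup∘tabulate (does ∘ essential? F) l))
                      (Vec.[]=⇒lookup l∈)
  ... | yes e | _ = e
  ... | no _  | ()

  ∈ess⁺ : ∀ {l} → Essential F l → l ∈ ess F
  ∈ess⁺ {l} e = Vec.lookup⇒[]= l (ess F)
    (trans (Vec.lookup∘tabulate (does ∘ essential? F) l) (dec-true (essential? F l) e))

  module Irreducibles (geo : AllGeodesic) (o : Vertex) where

    -- With the system ordered by moving away from `o`, such a vertex has exactly one lower
    -- neighbour, like a join-irreducible element.
    Irreducible : Label → Vertex → Set
    Irreducible l v = (∃ λ w → Toward o v l w) × (∀ {k w} → Toward o v k w → k ≡ l)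

    next-toward : ∀ {v} → v ≢ o → ∃₂ λ l w → Toward o v l w
    next-toward {v} v≢o with geo o v
    ... | here = contradiction refl v≢o
    ... | step s _ = _ , _ , s

    o-minimal : ∀ {l w} → ¬ Toward o o l w
    o-minimal s = away s refl

    -- Descend towards `o` along labels other than `l`: the bit at `l` keeps differing from that of
    -- `o`, and the distance `d` drops. Where this stops, the vertex is not `o`, so it has a step
    -- towards `o`, which must carry `l`.
    irreducible-below : ∀ {d l v} → dist v o ≡ d → bit v l ≢ bit o l → ∃ (Irreducible l)
    irreducible-below {d} {l} {v} e ne
      with any? (λ k → any? λ w → toward? o v k w ×-dec ¬? (k ≟ᶠ l))
    irreducible-below {zero} e ne | yes (k , w , s , k≢l)
      with () ← trans (sym e) (toward-dist s)
    irreducible-below {suc d} e ne | yes (k , w , s , k≢l) =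
      irreducible-below {d} (ℕ.suc-injective (trans (sym (toward-dist s)) e))
        (ne ∘ trans (sym (flip-off (proj₁ s) (k≢l ∘ sym))))
    irreducible-below {d} {l} {v} e ne | no none
      with k , w , s ← next-toward {v} (λ { refl → ne refl }) =
      v , (w , subst (λ j → Toward o v j w) (only s) s) , only
      where
      only : ∀ {k w} → Toward o v k w → k ≡ l
      only {k} s with k ≟ᶠ l
      ... | yes k≡l = k≡l
      ... | no k≢l  = contradiction (k , _ , s , k≢l) none

    essential⇒differs : ∀ {l} → Essential F l → ∃ λ v → bit v l ≢ bit o l
    essential⇒differs {l} ess with u , v , ne ← essential⇒separated ess
      with bit u l Bool.≟ bit o l
    ... | no ne′ = u , ne′
    ... | yes e  = v , λ e′ → ne (trans e (sym e′))

    -- The default value o is junk, for inessential labels only.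
    chosen : ∀ l → ∃ λ v → Essential F l → Irreducible l v
    chosen l with essential? F l
    ... | no ¬ess = o , λ ess → contradiction ess ¬ess
    ... | yes ess with v , ne ← essential⇒differs ess
                  with x , irr ← irreducible-below refl ne = x , λ _ → irr

    generator : Label → Vertex
    generator l = proj₁ (chosen l)

    generator-irreducible : ∀ {l} → Essential F l → Irreducible l (generator l)
    generator-irreducible = proj₂ (chosen _)

    generators : Subset size
    generators = image (ess F) generator

    generator-injective : ∀ {k l} → k ∈ ess F → l ∈ ess F →
                          generator k ≡ generator l → k ≡ l
    generator-injective {k} {l} k∈ l∈ e
      with (w , s) , _ ← generator-irreducible (∈ess⁻ k∈) =
      proj₂ (generator-irreducible (∈ess⁻ l∈)) (subst (λ v → Toward o v k w) e s)

    -- By injectivity there are as many generators as essential labels. Hence `∣ ess F ∣ ≤ size`,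
    -- the integer difference is a natural number, and it counts the remaining vertices.
    additionality≡ : additionality F ≡ + ∣ ∁ generators ∣
    additionality≡ = trans (ℤ.⊖-≥ (subst (_≤ size) ∣gen∣ (∣p∣≤n generators)))
      (cong +_ (trans (cong (size ∸_) (sym ∣gen∣)) (sym (∣∁p∣≡n∸∣p∣ generators))))
      where
      ∣gen∣ : ∣ generators ∣ ≡ ∣ ess F ∣
      ∣gen∣ = ∣image∣ (ess F) generator generator-injective

    ∈generators⁺ : ∀ {l} → Essential F l → generator l ∈ generators
    ∈generators⁺ e = ∈-image⁺ (ess F) (∈ess⁺ e)

    ∈generators⁻ : ∀ {v} → v ∈ generators → ∃ λ l → Irreducible l v × v ≡ generator l
    ∈generators⁻ v∈ with l , l∈ , refl ← ∈-image⁻ (ess F) v∈ =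
      l , generator-irreducible (∈ess⁻ l∈) , refl

    o∈∁generators : o ∈ ∁ generators
    o∈∁generators = x∉p⇒x∈∁p λ o∈ →
      o-minimal (proj₂ (proj₁ (proj₁ (proj₂ (∈generators⁻ o∈)))))

    -- From additionality 2 to a rigid system.

    module _ {s} (pair : IsPair o s (∁ generators)) where

      private
        o≢s : o ≢ s
        o≢s = proj₁ pair

        s∉generators : s ∉ generators
        s∉generators = x∈∁p⇒x∉p (proj₁ (proj₂ (proj₂ pair)))

        generated : ∀ {v k w} → v ≢ s → Toward o v k w →
                    ∃ λ l → Irreducible l v × v ≡ generator l
        generated {v} v≢s τ =
          ∈generators⁻ (x∉∁p⇒x∈p λ v∈ → absurd (proj₂ (proj₂ (proj₂ pair)) v∈))
          where
          absurd : v ≡ o ⊎ v ≡ s → ⊥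
          absurd (inj₁ refl) = o-minimal τ
          absurd (inj₂ v≡s)  = v≢s v≡s

      -- A vertex other than `s` with a step towards `o` is a generator, hence irreducible.
      unique-label : ∀ {v k l w x} → v ≢ s → Toward o v k w → Toward o v l x → k ≡ l
      unique-label v≢s τ τ′ with _ , (_ , only) , _ ← generated v≢s τ =
        trans (only τ) (sym (only τ′))

      -- Both upper ends are the one generator chosen for `l`.
      unique-upper : ∀ {u v l w x} → u ≢ s → v ≢ s →
                     Toward o u l w → Toward o v l x → u ≡ v
      unique-upper u≢s v≢s τ τ′
        with _ , (_ , only) , e ← generated u≢s τ | _ , (_ , only′) , e′ ← generated v≢s τ′ =
        trans e (trans (cong generator (trans (sym (only τ)) (only′ τ′))) (sym e′))

      upper-exists : ∀ {l v} → bit v l ≢ bit o l → ∃₂ λ x w → x ≢ s × Toward o x l w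
      upper-exists {l} ne with irr ← generator-irreducible (separated⇒essential ne)
        with (w , τ) , _ ← irr =
        generator l , w ,
        (λ e → s∉generators
          (subst (_∈ generators) e (∈generators⁺ (separated⇒essential ne)))) , τ

      -- Only steps away from `o` are recorded. A descent from a vertex other than `s` retraces the
      -- climb, because a single edge leads down from it.
      data Above (b : Label) : Vertex → Set where
        top : Above b s
        up  : ∀ {v k w} → Above b w → Toward o v k w → k ≢ b → Above b v

      -- If b were the only label leading from s towards o, the vertices that
      -- reach s without crossing b would be closed under steps not crossing b;
      -- but the other vertex x with b below it is not among them.
      not-above : ∀ {b u x w} → (∀ {k y} → Toward o s k y → k ≡ b) →
                  x ≢ s → Toward o x b w →
                  Geodesic x u → bit u b ≡ bit x b → ¬ Above b u
      not-above only x≢s τ here e top = x≢s refl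
      not-above only x≢s τ here e (up _ τ′ k≢b) = k≢b (unique-label x≢s τ′ τ)
      not-above {b} {u} {x} only x≢s τ (step {l = l} {u′} σ@(f , e′) γ) e above =
        not-above only x≢s τ γ (trans (flip-off f (l≢b ∘ sym)) e)
          (descend (bit u′ l Bool.≟ bit o l) above)
        where
        l≢b : l ≢ b
        l≢b refl = away σ e
        descend : Dec (bit u′ l ≡ bit o l) → Above b u → Above b u′
        descend (no ne) a = up a (toward (flip-sym f) ne) l≢b
        descend (yes e″) top = contradiction (only (f , e″)) l≢b
        descend (yes e″) a@(up a′ τ′ k≢b) with u ≟ᶠ s
        ... | yes refl = contradiction (only (f , e″)) l≢b
        ... | no u≢s with refl ← unique-label u≢s τ′ (f , e″) =
          subst (Above b) (flip-functional (proj₁ τ′) f) a′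

      -- Were `b` the only one, the generator of `b` would contradict `not-above`: it agrees with
      -- `s` at `b`, both differing from `o` there.
      second-label : ∀ {b w} → Toward o s b w → ∃₂ λ k y → Toward o s k y × k ≢ b
      second-label {b} τ with any? (λ k → any? λ y → toward? o s k y ×-dec ¬? (k ≟ᶠ b))
      ... | yes found = found
      ... | no none with x , _ , x≢s , σ ← upper-exists (away τ) =
        contradiction top (not-above only x≢s σ (geo x s) (≢-common (away τ) (away σ)))
        where
        only : ∀ {k y} → Toward o s k y → k ≡ b
        only {k} ρ with k ≟ᶠ b
        ... | yes k≡b = k≡b
        ... | no k≢b  = contradiction (k , _ , ρ , k≢b) none

      below≢s : ∀ {b w} → Toward o s b w → w ≢ s
      below≢s τ refl = flip-changes (proj₁ τ) refl

      -- Since `v` differs from `o` at `b`, it has a step towards `o`, say with label `y`. If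
      -- `y ≢ b`, then `w` differs from `o` at `y` too, and its geodesic to `o` crosses `y` from
      -- some `x` that agrees with `o` at `b`. But `unique-upper` forces `x` to be `v`.
      square-below : ∀ {a b v w} → Toward o s a v → Toward o s b w → a ≢ b →
                     ∃ λ t → Toward o v b t
      square-below {a} {b} {v} {w} τ σ a≢b = go (next-toward v≢o)
        where
        vb≢ : bit v b ≢ bit o b
        vb≢ = away σ ∘ trans (sym (flip-off (proj₁ τ) (a≢b ∘ sym)))
        v≢o : v ≢ o
        v≢o refl = vb≢ refl
        module _ {y t} (ρ : Toward o v y t) (y≢b : y ≢ b) where
          y≢a : y ≢ a
          y≢a refl = away ρ (proj₂ τ)
          wy≢ : bit w y ≢ bit o y
          wy≢ = away ρ ∘ trans (flip-off (proj₁ τ) y≢a) ∘ trans (sym (flip-off (proj₁ σ) y≢b))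
          wb≡ : ∀ {x} → Between x w o → bit x b ≡ bit o b
          wb≡ between with between b
          ... | inj₁ e = trans e (proj₂ σ)
          ... | inj₂ e = e
          clash : ⊥
          clash with x , _ , ρ′ , _ , between ← crossing (geo o w) wy≢
                with refl ← unique-upper (λ { refl → away σ (wb≡ between) }) (below≢s τ) ρ′ ρ =
            vb≢ (wb≡ between)
        go : (∃₂ λ y t → Toward o v y t) → ∃ λ t → Toward o v b t
        go (y , t , ρ) with y ≟ᶠ b
        ... | yes refl = t , ρ
        ... | no y≢b = ⊥-elim (clash ρ y≢b)

      -- By `square-below` a label `c` other than `a` would, like `b`, lead down from `v`, and only
      -- one label does.
      only-two-labels : ∀ {a b v w c x} → Toward o s a v → Toward o s b w → a ≢ b →
                        Toward o s c x → c ≡ a ⊎ c ≡ b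
      only-two-labels {a} {c = c} τ σ a≢b ρ with c ≟ᶠ a
      ... | yes c≡a = inj₁ c≡a
      ... | no c≢a  = inj₂ (unique-label (below≢s τ)
        (proj₂ (square-below τ ρ (c≢a ∘ sym))) (proj₂ (square-below τ σ a≢b)))

      module _ {a b v w t} (τ : Toward o s a v) (σ : Toward o s b w) (a≢b : a ≢ b)
               (ρ : Toward o w a t) where

        t-w : Flip t a w
        t-w = flip-sym (proj₁ ρ)

        t-v : Flip t b v
        t-v = flip-sym (parallel-flip (proj₁ τ) (proj₁ ρ) (proj₁ σ))

        w-s : Flip w b s
        w-s = flip-sym (proj₁ σ)

        top-square : Square
        top-square = square-from-path a≢b t-w t-v w-s

        open Square top-square

        relative-isCorner : ∀ x y → IsCorner (relative a≢b t-w t-v w-s x y)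
        relative-isCorner = relative-corner a≢b t-w t-v w-s

        upper-isCorner : ∀ {u l x} → Toward o u l x → l ≡ p ⊎ l ≡ q → IsCorner u
        upper-isCorner {u} υ side with u ≟ᶠ s | side
        ... | yes refl | _         = relative-isCorner true true
        ... | no u≢s   | inj₁ refl =
          subst IsCorner (unique-upper (below≢s σ) u≢s ρ υ) (relative-isCorner true false)
        ... | no u≢s   | inj₂ refl =
          subst IsCorner (unique-upper (below≢s τ) u≢s (proj₂ (square-below τ σ a≢b)) υ)
            (relative-isCorner false true)

        on-top-square : ∀ {u l x} → Flip u l x → l ≡ p ⊎ l ≡ q → IsCorner u
        on-top-square {u} {l} f side with bit u l Bool.≟ bit o l
        ... | no ne = upper-isCorner (toward f ne) side
        ... | yes e = isCorner-flip (flip-sym f) side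
          (upper-isCorner (flip-sym f , e) side)

        upper≢s : ∀ {u l x} → l ≢ p → l ≢ q → Toward o u l x → u ≢ s
        upper≢s l≢p l≢q υ refl with only-two-labels τ σ a≢b υ
        ... | inj₁ l≡p = l≢p l≡p
        ... | inj₂ l≡q = l≢q l≡q

        -- Equal bits make `u` and `x` both upper or both lower ends as seen from `o`. Upper ends
        -- other than `s` are unique for a label, and lower ends are their flips.
        rigid-off-square : ∀ {u l w x y} → l ≢ p → l ≢ q → Flip u l w → Flip x l y →
                           bit u l ≡ bit x l → u ≡ x
        rigid-off-square {u} {l} l≢p l≢q f g e with bit u l Bool.≟ bit o l
        ... | no ne = unique-upper (upper≢s l≢p l≢q υ) (upper≢s l≢p l≢q χ) υ χ
          where
          υ = toward f ne
          χ = toward g (ne ∘ trans e)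
        ... | yes e′ = flip-functional
          (subst (λ z → Flip z l u) (unique-upper (upper≢s l≢p l≢q υ) (upper≢s l≢p l≢q χ) υ χ)
            (flip-sym f))
          (flip-sym g)
          where
          υ = flip-sym f , e′
          χ = flip-sym g , trans (sym e) e′

      rigid-system : Rigid
      rigid-system
        with a , v , τ ← next-toward (o≢s ∘ sym)
        with b , w , σ , b≢a ← second-label τ
        with t , ρ ← square-below σ τ b≢a = record
        { square    = top-square τ σ (b≢a ∘ sym) ρ
        ; on-square = on-top-square τ σ (b≢a ∘ sym) ρ
        ; rigid     = rigid-off-square τ σ (b≢a ∘ sym) ρ
        ; connected = λ u x → _ , geodesic-walk (geo x u)
        }

  -- From a rigid system to additionality 2.

  module _ (R : Rigid) where
    open Rigid R
    private
      o s : Vertex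
      o = corner false false
      s = corner true true
    open Irreducibles allGeodesic o

    rigid⇒pair : IsPair o s (∁ generators)
    rigid⇒pair = o≢s , o∈∁generators , x∉p⇒x∈∁p s∉generators , only
      where
      o≢s : o ≢ s
      o≢s e with () ← trans (sym (at-p false false))
                        (trans (cong (λ v → bit v p) e) (at-p true true))

      -- The corner opposite to `o` has steps towards `o` with both labels `p` and `q`, so it is not
      -- irreducible.
      s∉generators : s ∉ generators
      s∉generators s∈ with _ , (_ , only) , _ ← ∈generators⁻ s∈ = p≢q (trans
        (only (flip-p true true , trans (at-p false true) (sym (at-p false false))))
        (sym (only (flip-q true true , trans (at-q true false) (sym (at-q false false))))))

      -- Compare the edge below `v` with the edge of the same label below its generator. If they are
      -- distinct, they are opposite sides of the square, joined by label `k`. If `v` agreed with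
      -- `o` at `k`, the generator would have a second label towards `o`; otherwise `v` differs from
      -- `o` at both `p` and `q`, hence is `s`.
      isGenerator : ∀ {v} → v ≢ o → v ≢ s → v ∈ generators
      isGenerator {v} v≢o v≢s with l , _ , τ ← next-toward v≢o
        with irr ← generator-irreducible (separated⇒essential (away τ))
        with (_ , σ) , only ← irr
        with parallel (proj₁ τ) (proj₁ σ) (≢-common (away τ) (away σ))
      ... | inj₁ e = subst (_∈ generators) (sym e)
                         (∈generators⁺ (separated⇒essential (away τ)))
      ... | inj₂ (k , f , kl) with bit v k Bool.≟ bit o k
      ...   | yes e = contradiction
                (only (toward (flip-sym f) λ e′ → flip-changes f (trans e′ (sym e))))
                (pq-distinct kl)
      ...   | no ne = contradiction (trans (on-square f (side kl)) (is-s kl)) v≢s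
        where
        side : ∀ {k l} → (k ≡ p × l ≡ q) ⊎ (k ≡ q × l ≡ p) → k ≡ p ⊎ k ≡ q
        side (inj₁ (e , _)) = inj₁ e
        side (inj₂ (e , _)) = inj₂ e
        high-p : bit v p ≢ bit o p → bit v p ≡ true
        high-p ne′ = trans (Bool.¬-not ne′) (cong not (at-p false false))
        high-q : bit v q ≢ bit o q → bit v q ≡ true
        high-q ne′ = trans (Bool.¬-not ne′) (cong not (at-q false false))
        is-s : (k ≡ p × l ≡ q) ⊎ (k ≡ q × l ≡ p) → corner (bit v p) (bit v q) ≡ s
        is-s (inj₁ (refl , refl)) = cong₂ corner (high-p ne) (high-q (away τ))
        is-s (inj₂ (refl , refl)) = cong₂ corner (high-p (away τ)) (high-q ne)

      only : ∀ {z} → z ∈ ∁ generators → z ≡ o ⊎ z ≡ s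
      only {z} z∈ with z ≟ᶠ o | z ≟ᶠ s
      ... | yes e | _     = inj₁ e
      ... | _     | yes e = inj₂ e
      ... | no ≢o | no ≢s = contradiction (isGenerator ≢o ≢s) (x∈∁p⇒x∉p z∈)

    rigid⇒additionality : additionality F ≡ + 2
    rigid⇒additionality = trans additionality≡ (cong +_ (pair⇒∣∣≡2 rigid⇒pair))

  -- Any base vertex lies outside the generators, so additionality 2 leaves exactly one further
  -- vertex `s`.
  additionality⇒rigid : AllGeodesic → additionality F ≡ + 2 → Vertex → Rigid
  additionality⇒rigid geo e o = rigid-system
    (proj₂ (∣∣≡2⇒pair (ℤ.+-injective (trans (sym additionality≡) e)) o∈∁generators))
    where open Irreducibles geo o

  -- Semitrees are rigid.

  adj-sym : ∀ {u v} → Adj u v → Adj v u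
  adj-sym (l , inj₁ e) = l , inj₂ e
  adj-sym (l , inj₂ e) = l , inj₁ e

  flip⇒edge⊎ : ∀ {u l v} → Flip u l v → Edge u l v ⊎ Edge v l u
  flip⇒edge⊎ {u} {l} f with bit u l in e
  ... | false = inj₁ (flip⇒edge f e)
  ... | true  = inj₂ (flip⇒edge (flip-sym f) (trans (flip-at f) (cong not e)))

  walk-++ : ∀ {u v w j k} → Walk u v j → Walk v w k → ∃ λ m → Walk u w m
  walk-++ here       W′ = _ , W′
  walk-++ (step a W) W′ = _ , step a (proj₂ (walk-++ W W′))

  onCycle-sym : ∀ {a u v} → OnCycle (oneInclusion F) a u v → OnCycle (oneInclusion F) a v u
  onCycle-sym (i , inj₁ (e , e′)) = i , inj₂ (e′ , e)
  onCycle-sym (i , inj₂ (e , e′)) = i , inj₁ (e′ , e)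

  onCycle? : ∀ a u v → Dec (OnCycle (oneInclusion F) a u v)
  onCycle? a u v = any? λ i → ((u ≟ᶠ a i) ×-dec (v ≟ᶠ a (next i))) ⊎-dec
                              ((u ≟ᶠ a (next i)) ×-dec (v ≟ᶠ a i))

  module _ (T : IsSemitree (oneInclusion F)) where
    open IsSemitree T
    open ParallelC4 cycle using (p; q; p≢q; p-sides; q-sides)

    private
      f₀₁ : Flip (a 0F) p (a 1F)
      f₀₁ with p-sides
      ... | inj₁ (e , _) = edge⇒flip e
      ... | inj₂ (e , _) = flip-sym (edge⇒flip e)

      f₃₂ : Flip (a 3F) p (a 2F)
      f₃₂ with p-sides
      ... | inj₁ (_ , e) = edge⇒flip e
      ... | inj₂ (_ , e) = flip-sym (edge⇒flip e)

      f₁₂ : Flip (a 1F) q (a 2F)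
      f₁₂ with q-sides
      ... | inj₁ (e , _) = edge⇒flip e
      ... | inj₂ (e , _) = flip-sym (edge⇒flip e)

      f₀₃ : Flip (a 0F) q (a 3F)
      f₀₃ with q-sides
      ... | inj₁ (_ , e) = edge⇒flip e
      ... | inj₂ (_ , e) = flip-sym (edge⇒flip e)

    cycle-square : Square
    cycle-square = square-from-path p≢q f₀₁ f₀₃ f₁₂

    open Square cycle-square using (IsCorner)

    cycle-isCorner : ∀ i → IsCorner (a i)
    cycle-isCorner 0F = relative-corner p≢q f₀₁ f₀₃ f₁₂ false false
    cycle-isCorner 1F = relative-corner p≢q f₀₁ f₀₃ f₁₂ true false
    cycle-isCorner 2F = relative-corner p≢q f₀₁ f₀₃ f₁₂ true true
    cycle-isCorner 3F = relative-corner p≢q f₀₁ f₀₃ f₁₂ false true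

    onCycle-isCorner : ∀ {u v} → OnCycle (oneInclusion F) a u v → IsCorner u
    onCycle-isCorner (i , inj₁ (refl , _)) = cycle-isCorner i
    onCycle-isCorner (i , inj₂ (refl , _)) = cycle-isCorner (next i)

    side-label : ∀ i {l} → Flip (a i) l (a (next i)) → l ≡ p ⊎ l ≡ q
    side-label 0F f = inj₁ (flip-label f f₀₁)
    side-label 1F f = inj₂ (flip-label f f₁₂)
    side-label 2F f = inj₁ (flip-label f (flip-sym f₃₂))
    side-label 3F f = inj₂ (flip-label f (flip-sym f₀₃))

    onCycle-label : ∀ {u l v} → Flip u l v → OnCycle (oneInclusion F) a u v → l ≡ p ⊎ l ≡ q
    onCycle-label f (i , inj₁ (refl , refl)) = side-label i f
    onCycle-label f (i , inj₂ (refl , refl)) = side-label i (flip-sym f)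

    offCycle-label : ∀ {u l v} → Flip u l v → ¬ OnCycle (oneInclusion F) a u v → l ≢ p × l ≢ q
    offCycle-label f off with flip⇒edge⊎ f
    ... | inj₁ e = labels-fresh e off
    ... | inj₂ e = labels-fresh e (off ∘ onCycle-sym {a})

    cycle-adj : ∀ i → Adj (a i) (a (next i))
    cycle-adj 0F = flip⇒adj f₀₁
    cycle-adj 1F = flip⇒adj f₁₂
    cycle-adj 2F = flip⇒adj (flip-sym f₃₂)
    cycle-adj 3F = flip⇒adj (flip-sym f₀₃)

    to-a₀ : ∀ i → ∃ (Walk (a i) (a 0F))
    to-a₀ 0F = _ , here
    to-a₀ 1F = _ , step (adj-sym (cycle-adj 0F)) here
    to-a₀ 2F = _ , step (cycle-adj 2F) (step (cycle-adj 3F) here)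
    to-a₀ 3F = _ , step (cycle-adj 3F) here

    from-a₀ : ∀ i → ∃ (Walk (a 0F) (a i))
    from-a₀ 0F = _ , here
    from-a₀ 1F = _ , step (cycle-adj 0F) here
    from-a₀ 2F = _ , step (cycle-adj 0F) (step (cycle-adj 1F) here)
    from-a₀ 3F = _ , step (adj-sym (cycle-adj 3F)) here

    forget : ∀ {P u v k} → Digraph.Walk (induced (oneInclusion F) P) u v k →
             Walk (proj₁ u) (proj₁ v) k
    forget Digraph.here       = here
    forget (Digraph.step e W) = step e (forget W)

    -- Leave the tree of `u` through its cycle vertex, pass through `a 0F`, and enter the tree of
    -- `v` at its cycle vertex.
    semitree-connected : Connected
    semitree-connected u v =
      walk-++ (forget (proj₂ (tree-connected (part u) (u , refl) (_ , attached _))))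
        (proj₂ (walk-++ (proj₂ (to-a₀ (part u))) (proj₂ (walk-++ (proj₂ (from-a₀ (part v)))
          (forget (proj₂ (tree-connected (part v) (_ , attached _) (v , refl))))))))
      where
      tree-connected : ∀ i → Digraph.Connected (induced (oneInclusion F) λ v → part v ≡ i)
      tree-connected i = proj₁ (proj₂ (trees i))

    semitree⇒rigid : Rigid
    semitree⇒rigid = record
      { square    = cycle-square
      ; on-square = on-square
      ; rigid     = rigid
      ; connected = semitree-connected
      }
      where
      on-square : ∀ {u l v} → Flip u l v → l ≡ p ⊎ l ≡ q → IsCorner u
      on-square {u} {l} {v} f side with onCycle? a u v | side
      ... | yes on | _      = onCycle-isCorner on
      ... | no off | inj₁ e = contradiction e (proj₁ (offCycle-label f off))
      ... | no off | inj₂ e = contradiction e (proj₂ (offCycle-label f off))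

      off-square : ∀ {l} → l ≢ p → l ≢ q → ¬ (l ≡ p ⊎ l ≡ q)
      off-square l≢p l≢q (inj₁ l≡p) = l≢p l≡p
      off-square l≢p l≢q (inj₂ l≡q) = l≢q l≡q

      rigid : ∀ {u l w x y} → l ≢ p → l ≢ q → Flip u l w → Flip x l y →
              bit u l ≡ bit x l → u ≡ x
      -- The common bit tells which ends are compared: `u` and `x` are sources if it is false and
      -- targets if it is true.
      rigid {u} {l} l≢p l≢q f g e with bit u l in e′
      ... | false = proj₁ (labels-distinct (flip⇒edge f e′) (off f)
                             (flip⇒edge g (sym e)) (off g))
        where
        off : ∀ {u v} → Flip u l v → ¬ OnCycle (oneInclusion F) a u v
        off f = off-square l≢p l≢q ∘ onCycle-label f
      ... | true  = proj₂ (labels-distinct (low f e′) (off f) (low g (sym e)) (off g))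
        where
        off : ∀ {u v} → Flip u l v → ¬ OnCycle (oneInclusion F) a v u
        off f = off-square l≢p l≢q ∘ onCycle-label (flip-sym f)
        low : ∀ {u v} → Flip u l v → bit u l ≡ true → Edge v l u
        low f e = flip⇒edge (flip-sym f) (trans (flip-at f) (cong not e))

  -- Rigid systems are semitrees.

  module _ (R : Rigid) where
    open Rigid R
    private
      G : Digraph
      G = oneInclusion F

    -- The bits at `p` and `q` run through 00, 10, 11, 01, so cyclically consecutive corners differ
    -- in one bit.
    col row : Fin 4 → Bool
    col 0F = false
    col 1F = true
    col 2F = true
    col 3F = false
    row 0F = false
    row 1F = false
    row 2F = true
    row 3F = true

    place : Bool → Bool → Fin 4
    place false false = 0F
    place true  false = 1F
    place true  true  = 2F
    place false true  = 3F

    col-place : ∀ α β → col (place α β) ≡ α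
    col-place false false = refl
    col-place true  false = refl
    col-place true  true  = refl
    col-place false true  = refl

    row-place : ∀ α β → row (place α β) ≡ β
    row-place false false = refl
    row-place true  false = refl
    row-place true  true  = refl
    row-place false true  = refl

    place-col-row : ∀ i → place (col i) (row i) ≡ i
    place-col-row 0F = refl
    place-col-row 1F = refl
    place-col-row 2F = refl
    place-col-row 3F = refl

    a : Fin 4 → Vertex
    a i = corner (col i) (row i)

    -- Off the square no edge changes the bits at `p` and `q`, so these bits tell the attached trees
    -- apart.
    part : Vertex → Fin 4
    part v = place (bit v p) (bit v q)

    attached : ∀ i → part (a i) ≡ i
    attached i = trans (cong₂ place (at-p _ _) (at-q _ _)) (place-col-row i)

    part-p : ∀ {v i} → part v ≡ i → bit v p ≡ col i
    part-p {v} e = trans (sym (col-place _ _)) (cong col e)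

    part-q : ∀ {v i} → part v ≡ i → bit v q ≡ row i
    part-q {v} e = trans (sym (row-place _ _)) (cong row e)

    part-flip : ∀ {u l v} → Flip u l v → l ≢ p → l ≢ q → part u ≡ part v
    part-flip f l≢p l≢q =
      sym (cong₂ place (flip-off f (l≢p ∘ sym)) (flip-off f (l≢q ∘ sym)))

    p-side : ∀ α β → OnCycle G a (corner α β) (corner (not α) β)
    p-side false false = 0F , inj₁ (refl , refl)
    p-side true  false = 0F , inj₂ (refl , refl)
    p-side false true  = 2F , inj₂ (refl , refl)
    p-side true  true  = 2F , inj₁ (refl , refl)

    q-side : ∀ α β → OnCycle G a (corner α β) (corner α (not β))
    q-side false false = 3F , inj₂ (refl , refl)
    q-side false true  = 3F , inj₁ (refl , refl)
    q-side true  false = 1F , inj₁ (refl , refl)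
    q-side true  true  = 1F , inj₂ (refl , refl)

    flip-onCycle : ∀ {u l v} → Flip u l v → l ≡ p ⊎ l ≡ q → OnCycle G a u v
    flip-onCycle {u} {v = v} f side@(inj₁ refl) = subst₂ (OnCycle G a)
      (sym (on-square f side))
      (trans (cong₂ corner (sym (flip-at f)) (sym (flip-off f (p≢q ∘ sym))))
        (sym (on-square (flip-sym f) side)))
      (p-side (bit u p) (bit u q))
    flip-onCycle {u} {v = v} f side@(inj₂ refl) = subst₂ (OnCycle G a)
      (sym (on-square f side))
      (trans (cong₂ corner (sym (flip-off f p≢q)) (sym (flip-at f)))
        (sym (on-square (flip-sym f) side)))
      (q-side (bit u p) (bit u q))

    Part : Fin 4 → Digraph
    Part i = induced G λ v → part v ≡ i

    -- A geodesic never crosses a label at which its ends agree, and the vertices of one part agree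
    -- at `p` and `q`, so the geodesic stays inside.
    part-connected : ∀ i → Digraph.Connected (Part i)
    part-connected i (u , pu) (t , pt) = go (allGeodesic t u) pu pt
      where
      go : ∀ {u t} → Geodesic t u → (pu : part u ≡ i) (pt : part t ≡ i) →
           ∃ (Digraph.Walk (Part i) (u , pu) (t , pt))
      go here refl refl = _ , Digraph.here
      go {u} {t} (step {l = l} {w} s γ) pu pt =
        _ , Digraph.step (flip⇒adj (proj₁ s)) (proj₂ (go γ pw pt))
        where
        pw : part w ≡ i
        pw = trans (sym (part-flip (proj₁ s)
          (λ { refl → away s (trans (part-p pu) (sym (part-p pt))) })
          (λ { refl → away s (trans (part-q pu) (sym (part-q pt))) }))) pu

    -- Follow the list up to the first step labelled `l`, where the hypothesis applies; before it,
    -- or all the way to `v` if there is none, the bit at `l` is unchanged.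
    no-crossing : ∀ {i l} (z : Σ Vertex λ v → part v ≡ i) zs v →
                  Linked (Digraph.Adj (Part i)) (z ∷ zs ∷ʳ v) →
                  All (λ z → ∀ {y} → Flip (proj₁ z) l y →
                             bit (proj₁ z) l ≡ bit (proj₁ v) l) (z ∷ zs) →
                  bit (proj₁ z) l ≡ bit (proj₁ v) l
    no-crossing {l = l} z [] v (e ∷ _) (stay ∷ _) with k , f ← adj⇒flip e | k ≟ᶠ l
    ... | yes refl = stay f
    ... | no k≢l   = sym (flip-off f (k≢l ∘ sym))
    no-crossing {l = l} z (z′ ∷ zs) v (e ∷ es) (stay ∷ stays) with k , f ← adj⇒flip e | k ≟ᶠ l
    ... | yes refl = stay f
    ... | no k≢l   = trans (sym (flip-off f (k≢l ∘ sym))) (no-crossing z′ zs v es stays)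

    -- The second crossing of the label of the first edge v—v₁ must start at v₁
    -- again, because rigidity leaves only this edge with that label.
    part-acyclic : ∀ i → ¬ Digraph.HasCycle (Part i)
    part-acyclic i (v , [] , () , _)
    part-acyclic i (v , _ ∷ [] , s≤s () , _)
    part-acyclic i ((v , pv) , (v₁ , pv₁) ∷ (v₂ , pv₂) ∷ vs , _ ,
                    (_ ∷ v≢v₂ ∷ _) ∷ v₁≢ ∷ _ , e ∷ e₁ ∷ es)
      with l , f ← adj⇒flip e | k , f₁ ← adj⇒flip e₁ = absurd (k ≟ᶠ l)
      where
      l≢p : l ≢ p
      l≢p refl = flip-changes f (trans (part-p pv₁) (sym (part-p pv)))
      l≢q : l ≢ q
      l≢q refl = flip-changes f (trans (part-q pv₁) (sym (part-q pv)))
      same : ∀ {u w : Σ Vertex λ v → part v ≡ i} → proj₁ u ≡ proj₁ w → u ≡ w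
      same {_ , refl} {_ , refl} refl = refl
      stay : ∀ {z : Σ Vertex λ v → part v ≡ i} → (v₁ , pv₁) ≢ z →
             ∀ {y} → Flip (proj₁ z) l y → bit (proj₁ z) l ≡ bit v l
      stay {z , _} v₁≢z g with bit z l Bool.≟ bit v l
      ... | yes e = e
      ... | no ne = contradiction
        (same (rigid l≢p l≢q (flip-sym f) g (≢-common (flip-changes f) ne))) v₁≢z
      absurd : Dec (k ≡ l) → ⊥
      absurd (yes refl) = v≢v₂ (same (flip-functional (flip-sym f) f₁))
      absurd (no k≢l) = flip-changes f (trans (sym (flip-off f₁ (k≢l ∘ sym)))
        (no-crossing _ vs (v , pv) es (All.map stay v₁≢)))

    rigid⇒semitree : IsSemitree G
    rigid⇒semitree = record
      { a = a
      ; cycle = record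
        { distinct = λ {i} {j} e → trans (sym (attached i)) (trans (cong part e) (attached j))
        ; p = p
        ; q = q
        ; p≢q = p≢q
        ; p-sides = inj₁ (flip⇒edge (flip-p false false) (at-p false false) ,
                          flip⇒edge (flip-p false true) (at-p false true))
        ; q-sides = inj₁ (flip⇒edge (flip-q true false) (at-q true false) ,
                          flip⇒edge (flip-q false false) (at-q false false))
        }
      ; part = part
      ; attached = attached
      ; trees = λ i → (a i , attached i) , part-connected i , part-acyclic i
      ; edges = edges
      ; labels-fresh = labels-fresh
      ; labels-distinct = labels-distinct
      }
      where
      edges : ∀ {u l v} → Edge u l v → OnCycle G a u v ⊎ part u ≡ part v
      edges {l = l} e with l ≟ᶠ p | l ≟ᶠ q
      ... | yes l≡p | _       = inj₁ (flip-onCycle (edge⇒flip e) (inj₁ l≡p))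
      ... | _       | yes l≡q = inj₁ (flip-onCycle (edge⇒flip e) (inj₂ l≡q))
      ... | no l≢p  | no l≢q  = inj₂ (part-flip (edge⇒flip e) l≢p l≢q)

      labels-fresh : ∀ {u l v} → Edge u l v → ¬ OnCycle G a u v → l ≢ p × l ≢ q
      labels-fresh e off = off ∘ flip-onCycle (edge⇒flip e) ∘ inj₁ ,
                           off ∘ flip-onCycle (edge⇒flip e) ∘ inj₂

      labels-distinct : ∀ {u v u′ v′ l} → Edge u l v → ¬ OnCycle G a u v →
                        Edge u′ l v′ → ¬ OnCycle G a u′ v′ → u ≡ u′ × v ≡ v′
      labels-distinct e off e′ off′
        with refl ← rigid (proj₁ (labels-fresh e off)) (proj₂ (labels-fresh e off))
               (edge⇒flip e) (edge⇒flip e′) (trans (edge⇒low e) (sym (edge⇒low e′))) =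
        refl , flip-functional (edge⇒flip e) (edge⇒flip e′)

  semitree⇒wellGraded : IsSemitree (oneInclusion F) → WellGraded F × additionality F ≡ + 2
  semitree⇒wellGraded T = geodesic⇒wellGraded (Rigid.allGeodesic R) , rigid⇒additionality R
    where R = semitree⇒rigid T

  wellGraded⇒semitree : Vertex → WellGraded F × additionality F ≡ + 2 →
                        IsSemitree (oneInclusion F)
  wellGraded⇒semitree o (wg , e) =
    rigid⇒semitree (additionality⇒rigid (wellGraded⇒geodesic wg) e o)

  -- Direction away from the empty set.

  distance-unique : ∀ {u v d e} → HasDistance u v d → HasDistance u v e → d ≡ e
  distance-unique (finite W m) (finite W′ m′) = cong [_] (ℕ.≤-antisym (m W′) (m′ W))
  distance-unique (finite W _) (infinite none) = contradiction W none
  distance-unique (infinite none) (finite W _) = contradiction W none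
  distance-unique (infinite _) (infinite _) = refl

  edge-dist : ∀ {o} → (∀ l → bit o l ≡ false) → ∀ {u l v} → Edge u l v →
              dist o v ≡ suc (dist o u)
  edge-dist {o} empty {u} {l} {v} e = trans (dist-comm o v) (trans
    (toward-dist (flip-sym (edge⇒flip e) , trans (edge⇒low e) (sym (empty l))))
    (cong suc (dist-comm u o)))

  -- By well-gradedness the distance from the empty set is cardinality, which every edge increases
  -- by one; an edge from `v` to `u` would make `v` the closer vertex.
  directedFrom-∅ : WellGraded F → ∀ {o} → (∀ l → bit o l ≡ false) →
                   DirectedFrom (oneInclusion F) o
  directedFrom-∅ wg {o} empty u v adj = mk⇔ away-from (back adj)
    where
    away-from : ∃ (λ l → Edge u l v) → Closer (oneInclusion F) o u v
    away-from (l , e) = _ , _ , wg o u , wg o v ,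
      [ ℕ.≤-reflexive (sym (edge-dist empty e)) ]
    back : Adj u v → Closer (oneInclusion F) o u v → ∃ (λ l → Edge u l v)
    back (l , inj₁ e) _ = l , e
    back (l , inj₂ e) (_ , _ , du , dv , lt)
      with refl ← distance-unique du (wg o u) | refl ← distance-unique dv (wg o v)
      with [ lt′ ] ← lt =
      contradiction lt′ (ℕ.<-asym (ℕ.≤-reflexive (sym (edge-dist empty e))))

-- Invariance under flipping.

module _ {n : ℕ} (F : SetSystem n) (D : Subset n) where
  open SetSystem F
  private
    F′ : SetSystem n
    F′ = flip-to-∅ F D
    module G = Graded F
    module G′ = Graded F′

  bit-flip : ∀ v l → G′.bit v l ≡ G.bit v l xor lookup D l
  bit-flip v l = lookup-△ (member v) D l

  toward-flip⁺ : ∀ {t u l w} → G.Toward t u l w → G′.Toward t u l w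
  toward-flip⁺ {t} {u} {l} {w} (f , e) =
    trans (cong (_△ D) f) (toggle-△ l (member u) D) ,
    trans (bit-flip w l) (trans (cong (_xor lookup D l) e) (sym (bit-flip t l)))

  toward-flip⁻ : ∀ {t u l w} → G′.Toward t u l w → G.Toward t u l w
  toward-flip⁻ {t} {u} {l} {w} (f , e) =
    △-cancelʳ D (trans f (sym (toggle-△ l (member u) D))) ,
    xor-injectiveˡ (lookup D l) (trans (sym (bit-flip w l)) (trans e (bit-flip t l)))

  geodesic-flip⁺ : ∀ {t u} → G.Geodesic t u → G′.Geodesic t u
  geodesic-flip⁺ G.here       = G′.here
  geodesic-flip⁺ (G.step s γ) = G′.step (toward-flip⁺ s) (geodesic-flip⁺ γ)

  geodesic-flip⁻ : ∀ {t u} → G′.Geodesic t u → G.Geodesic t u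
  geodesic-flip⁻ G′.here       = G.here
  geodesic-flip⁻ (G′.step s γ) = G.step (toward-flip⁻ s) (geodesic-flip⁻ γ)

  -- Either all members change at `l` or none does, so the same pairs of members differ at `l`.
  ess-flip : ess F′ ≡ ess F
  ess-flip = ⊆-antisym to from
    where
    to : ess F′ ⊆ ess F
    to {l} l∈ with u , v , ne ← G′.essential⇒separated (G′.∈ess⁻ l∈) =
      G.∈ess⁺ (G.separated⇒essential λ e → ne
        (trans (bit-flip u l) (trans (cong (_xor lookup D l) e) (sym (bit-flip v l)))))
    from : ess F ⊆ ess F′
    from {l} l∈ with u , v , ne ← G.essential⇒separated (G.∈ess⁻ l∈) =
      G′.∈ess⁺ (G′.separated⇒essential λ e → ne
        (xor-injectiveˡ (lookup D l) (trans (sym (bit-flip u l)) (trans e (bit-flip v l)))))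

  additionality-flip : additionality F′ ≡ additionality F
  additionality-flip = cong (λ A → size ⊖ ∣ A ∣) ess-flip

  wellGraded-flip⁺ : WellGraded F → WellGraded F′
  wellGraded-flip⁺ wg =
    G′.geodesic⇒wellGraded λ t u → geodesic-flip⁺ (G.wellGraded⇒geodesic wg t u)

  wellGraded-flip⁻ : WellGraded F′ → WellGraded F
  wellGraded-flip⁻ wg =
    G.geodesic⇒wellGraded λ t u → geodesic-flip⁻ (G′.wellGraded⇒geodesic wg t u)

  flip-empty : ∀ {o} → member o ≡ D → ∀ l → G′.bit o l ≡ false
  flip-empty {o} e l =
    trans (bit-flip o l)
      (trans (cong (λ A → lookup A l xor lookup D l) e) (Bool.xor-same (lookup D l)))

  flip-uniformlyDirected : WellGraded F × additionality F ≡ + 2 → D ∈ₛ F →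
                           IsUniformlyDirectedSemitree (oneInclusion F′)
  flip-uniformlyDirected (wg , e) (o , o≡D) =
    G′.wellGraded⇒semitree o (wg′ , trans additionality-flip e) ,
    -- The vertex of `D` becomes the empty set and serves as the root.
    inj₂ (o , G′.directedFrom-∅ wg′ (flip-empty o≡D))
    where
    wg′ : WellGraded F′
    wg′ = wellGraded-flip⁺ wg

  flip-semitree⁻ : IsSemitree (oneInclusion F′) → WellGraded F × additionality F ≡ + 2
  flip-semitree⁻ T with wg , e ← G′.semitree⇒wellGraded T =
    wellGraded-flip⁻ wg , trans (sym additionality-flip) e

theorem3p11 : (n : ℕ) (F : SetSystem n) →
    let
      S₁ = WellGraded F × additionality F ≡ + 2
      S₂ = ∀ D → D ∈ₛ F → IsUniformlyDirectedSemitree (oneInclusion (flip-to-∅ F D))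
      S₃ = ∃ λ D → D ∈ₛ F × IsUniformlyDirectedSemitree (oneInclusion (flip-to-∅ F D))
      S₄ = IsSemitree (oneInclusion F)
    in (S₁ ⇔ S₂) × (S₂ ⇔ S₃) × (S₃ ⇔ S₄)
theorem3p11 n F =
  mk⇔ 1⇒2 (3⇒1 ∘ 2⇒3) , mk⇔ 2⇒3 (1⇒2 ∘ 3⇒1) , mk⇔ (1⇒4 ∘ 3⇒1) (2⇒3 ∘ 1⇒2 ∘ 4⇒1)
  where
  open SetSystem F
  -- A base vertex exists since the family is nonempty; `2⇒3` takes its member as `D`, and `1⇒4`
  -- starts from it.
  o : Fin size
  o = fromℕ< (ℕ.n≢0⇒n>0 (≢-nonZero⁻¹ size {{nonempty}}))
  1⇒2 : WellGraded F × additionality F ≡ + 2 →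
        ∀ D → D ∈ₛ F → IsUniformlyDirectedSemitree (oneInclusion (flip-to-∅ F D))
  1⇒2 h D = flip-uniformlyDirected F D h
  2⇒3 : (∀ D → D ∈ₛ F → IsUniformlyDirectedSemitree (oneInclusion (flip-to-∅ F D))) →
        ∃ λ D → D ∈ₛ F × IsUniformlyDirectedSemitree (oneInclusion (flip-to-∅ F D))
  2⇒3 h = member o , (o , refl) , h (member o) (o , refl)
  3⇒1 : (∃ λ D → D ∈ₛ F × IsUniformlyDirectedSemitree (oneInclusion (flip-to-∅ F D))) →
        WellGraded F × additionality F ≡ + 2
  3⇒1 (D , _ , T , _) = flip-semitree⁻ F D T
  1⇒4 : WellGraded F × additionality F ≡ + 2 → IsSemitree (oneInclusion F)
  1⇒4 = Graded.wellGraded⇒semitree F o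
  4⇒1 : IsSemitree (oneInclusion F) → WellGraded F × additionality F ≡ + 2
  4⇒1 = Graded.semitree⇒wellGraded F
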